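{- Let $\mathcal V$ be a univalent universe and assume set replacement. Then for every type $I:\mathcal V$ and every family $\alpha:I\to\mathrm{Ord}_{\mathcal V}$ of ordinals, $\alpha$ has a least upper bound in $\mathrm{Ord}_{\mathcal V}$ with respect to $\preceq$.
   Context: Setting: intensional Martin-Löf type theory with non-cumulative universes, function extensionality, propositional extensionality, propositional truncations ($\exists$ denotes the truncated $\Sigma$). An ordinal in $\mathcal V$ is a type $\alpha:\mathcal V$ with a relation $\prec:\alpha\to\alpha\to\mathcal V$ that is proposition-valued, transitive, extensional and well-founded. $\mathrm{Ord}_{\mathcal V}$ is the type of ordinals in $\mathcal V$ (a type in $\mathcal V^+$). For $x:\alpha$, $\alpha\downarrow x$ is the ordinal of $b:\alpha$ with $b\prec x$. For $\alpha,\beta:\mathrm{Ord}_{\mathcal V}$, $\alpha\prec\beta$ iff there exists $y:\beta$ with $\alpha$ isomorphic to $\beta\downarrow y$; $\alpha\preceq\beta$ iff every $\gamma\prec\alpha$ satisfies $\gamma\prec\beta$. Set replacement: for all universes $\mathcal U,\mathcal W$ and every map $f:X\to Y$ with $X$ $\mathcal U$-small (equivalent to a type in $\mathcal U$) and $Y$ a set all of whose identity types are $\mathcal W$-small, the image $\Sigma_{y:Y}\exists_{x:X}f(x)=y$ is $(\mathcal U\sqcup\mathcal W)$-small. -}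

{-# OPTIONS --without-K #-}
module Defs where

open import Level using (Level; _⊔_; suc; Setω)
open import Data.Product using (Σ; _,_; proj₁; proj₂; _×_)
open import Relation.Binary.PropositionalEquality using (_≡_; refl; subst; cong)
open import Induction.WellFounded using (WellFounded; Acc; acc)

private variable
  a b ℓ : Level

isProp : Set a → Set a
isProp A = (x y : A) → x ≡ y

isSet : Set a → Set a
isSet A = (x y : A) → isProp (x ≡ y)

isContr : Set a → Set a
isContr A = Σ A λ c → (x : A) → c ≡ x

fiber : {A : Set a} {B : Set b} → (A → B) → B → Set (a ⊔ b)
fiber {A = A} f y = Σ A λ x → f x ≡ y

isEquiv : {A : Set a} {B : Set b} → (A → B) → Set (a ⊔ b)
isEquiv {B = B} f = (y : B) → isContr (fiber f y)

_≃_ : Set a → Set b → Set (a ⊔ b)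
A ≃ B = Σ (A → B) isEquiv

idtoeqv : {A B : Set a} → A ≡ B → A ≃ B
idtoeqv refl = (λ x → x) , λ y → (y , refl) , λ { (x , refl) → refl }

IsUnivalent : (ℓ : Level) → Set (suc ℓ)
IsUnivalent ℓ = (A B : Set ℓ) → isEquiv (idtoeqv {A = A} {B = B})

FunExt : Setω
FunExt = ∀ {a b} {A : Set a} {B : A → Set b} {f g : (x : A) → B x}
       → ((x : A) → f x ≡ g x) → f ≡ g

PropExt : Setω
PropExt = ∀ {a} {P Q : Set a} → isProp P → isProp Q → (P → Q) → (Q → P) → P ≡ Q

record PropTrunc : Setω where
  field
    ∥_∥    : ∀ {a} → Set a → Set a
    squash : ∀ {a} {A : Set a} → isProp ∥ A ∥
    ∣_∣    : ∀ {a} {A : Set a} → A → ∥ A ∥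
    rec    : ∀ {a b} {A : Set a} {P : Set b} → isProp P → (A → P) → ∥ A ∥ → P

∃ₜ : (T : PropTrunc) → (A : Set a) → (A → Set b) → Set (a ⊔ b)
∃ₜ T A B = PropTrunc.∥_∥ T (Σ A B)

IsSmall : (ℓ : Level) → Set a → Set (suc ℓ ⊔ a)
IsSmall ℓ X = Σ (Set ℓ) λ X' → X' ≃ X

SetReplacement : PropTrunc → Setω
SetReplacement T =
  ∀ {u w x y} {X : Set x} {Y : Set y} (f : X → Y)
  → IsSmall u X
  → isSet Y
  → ((y₁ y₂ : Y) → IsSmall w (y₁ ≡ y₂))
  → IsSmall (u ⊔ w) (Σ Y λ y₀ → ∃ₜ T X λ x₀ → f x₀ ≡ y₀)

record Ordinal (ℓ : Level) : Set (suc ℓ) where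
  field
    Carrier     : Set ℓ
    _≺_         : Carrier → Carrier → Set ℓ
    ≺-prop      : (x y : Carrier) → isProp (x ≺ y)
    ≺-trans     : (x y z : Carrier) → x ≺ y → y ≺ z → x ≺ z
    ≺-ext       : (x y : Carrier)
                → ((u : Carrier) → u ≺ x → u ≺ y)
                → ((u : Carrier) → u ≺ y → u ≺ x)
                → x ≡ y
    ≺-wf        : WellFounded _≺_

open Ordinal public

Ord : (ℓ : Level) → Set (suc ℓ)
Ord ℓ = Ordinal ℓ

_≅ₒ_ : Ordinal a → Ordinal b → Set (a ⊔ b)
α ≅ₒ β = Σ (Carrier α → Carrier β) λ f →
           isEquiv f
         × ((x y : Carrier α) → _≺_ α x y → _≺_ β (f x) (f y))
         × ((x y : Carrier α) → _≺_ β (f x) (f y) → _≺_ α x y)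

module _ (α : Ordinal ℓ) (x : Carrier α) where
  private
    A = Carrier α
    _<_ = _≺_ α
    S = Σ A λ b → b < x
    _<S_ : S → S → Set ℓ
    s <S t = proj₁ s < proj₁ t

    S-eq : (s t : S) → proj₁ s ≡ proj₁ t → s ≡ t
    S-eq (b , p) (.b , q) refl = cong (b ,_) (≺-prop α b x p q)

    S-acc : (b : A) → Acc _<_ b → (p : b < x) → Acc _<S_ (b , p)
    S-acc b (acc h) p = acc λ { {c , q} r → S-acc c (h r) q }

  _↓_ : Ordinal ℓ
  _↓_ = record
    { Carrier = S
    ; _≺_ = _<S_
    ; ≺-prop = λ s t → ≺-prop α (proj₁ s) (proj₁ t)
    ; ≺-trans = λ s t u → ≺-trans α (proj₁ s) (proj₁ t) (proj₁ u)
    ; ≺-ext = λ s t h k → S-eq s t (≺-ext α (proj₁ s) (proj₁ t)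
          (λ u u<s → h (u , ≺-trans α u (proj₁ s) x u<s (proj₂ s)) u<s)
          (λ u u<t → k (u , ≺-trans α u (proj₁ t) x u<t (proj₂ t)) u<t))
    ; ≺-wf = λ { (b , p) → S-acc b (≺-wf α b) p }
    }

_⊢_≺ₒ_ : PropTrunc → Ord ℓ → Ord ℓ → Set ℓ
T ⊢ α ≺ₒ β = ∃ₜ T (Carrier β) λ y → α ≅ₒ (β ↓ y)

_⊢_≼ₒ_ : PropTrunc → Ord ℓ → Ord ℓ → Set (suc ℓ)
_⊢_≼ₒ_ {ℓ} T α β = (γ : Ord ℓ) → T ⊢ γ ≺ₒ α → T ⊢ γ ≺ₒ β

IsLUB : PropTrunc → {I : Set a} → (I → Ord ℓ) → Ord ℓ → Set (a ⊔ suc ℓ)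
IsLUB {ℓ = ℓ} T {I} α β =
    ((i : I) → T ⊢ α i ≼ₒ β)
  × ((γ : Ord ℓ) → ((i : I) → T ⊢ α i ≼ₒ γ) → T ⊢ β ≼ₒ γ)

HasLUB : PropTrunc → {I : Set a} → (I → Ord ℓ) → Set (a ⊔ suc ℓ)
HasLUB {ℓ = ℓ} T α = Σ (Ord ℓ) λ β → IsLUB T α β

{-# OPTIONS --without-K #-}
-- Let Points be Σ i, α i and send a point a = (i , x) to its segment α i ↓ x.
-- Instead of taking the image of a ↦ α i ↓ x in Ord 𝓥 (whose identity types
-- are small only by univalence), take the image of a ↦ below a, the
-- predicate "the segment of c is a proper initial segment of that of a" on
-- Points.  These predicates form a set with 𝓥-small identity types by
-- function and propositional extensionality, and below a ≡ below b exactly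
-- when the two segments are isomorphic; so set replacement makes the image
-- small, and ordered by membership it is an ordinal whose initial segment at
-- below a is isomorphic to the segment of a.  Every proper initial segment of
-- α i is then one of the supremum, and every proper initial segment of the
-- supremum is one of some α i, which gives both the bound and leastness.

module Submission where

open import Defs
open import Level using (Level) renaming (suc to lsuc)
open import Function using (id; _∘_)
open import Data.Product using (Σ; _,_; proj₁; proj₂; _×_)
open import Data.Product.Properties using (×-≡,≡→≡)
open import Data.Unit using (⊤; tt)
open import Relation.Binary.PropositionalEquality
  using (_≡_; refl; sym; trans; cong; subst; subst₂)
open import Axiom.UniquenessOfIdentityProofs using (module Constant⇒UIP)
open import Induction.WellFounded using (WellFounded; Acc; acc)
import Relation.Binary.Construct.On as On

private variable
  a b ℓ : Level

Σ-≡-prop : {A : Set a} {B : A → Set b} → ((x : A) → isProp (B x))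
         → {s t : Σ A B} → proj₁ s ≡ proj₁ t → s ≡ t
Σ-≡-prop B-prop {x , p} {.x , q} refl = cong (x ,_) (B-prop x p q)

×-isProp : {A : Set a} {B : Set b} → isProp A → isProp B → isProp (A × B)
×-isProp A-prop B-prop (x , y) (x' , y') = ×-≡,≡→≡ (A-prop x x' , B-prop y y')

-- Hedberg: normalising paths through R is a constant endomap of x ≡ y.
isSet-from-relation : {A : Set a} (R : A → A → Set b) → (∀ x y → isProp (R x y))
                    → (∀ x → R x x) → (∀ {x y} → R x y → x ≡ y) → isSet A
isSet-from-relation {A = A} R R-prop R-refl R⇒≡ _ _ =
  Constant⇒UIP.≡-irrelevant normalise normalise-constant
  where
  normalise : {x y : A} → x ≡ y → x ≡ y
  normalise {x} p = R⇒≡ (subst (R x) p (R-refl x))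

  normalise-constant : {x y : A} (p q : x ≡ y) → normalise p ≡ normalise q
  normalise-constant {x} {y} _ _ = cong R⇒≡ (R-prop x y _ _)

isProp⇒isSet : {A : Set a} → isProp A → isSet A
isProp⇒isSet A-prop =
  isSet-from-relation (λ _ _ → ⊤) (λ _ _ _ _ → refl) (λ _ → tt) (λ {x} {y} _ → A-prop x y)

id-isEquiv : {A : Set a} → isEquiv (id {A = A})
id-isEquiv y = (y , refl) , λ { (x , refl) → refl }

quasiInverse⇒isEquiv : {A : Set a} {B : Set b} (f : A → B) (g : B → A)
                     → (∀ x → g (f x) ≡ x) → (∀ y → f (g y) ≡ y) → isSet B → isEquiv f
quasiInverse⇒isEquiv f g gf fg B-set y =
  (g y , fg y) , λ { (x , fx≡y) → Σ-≡-prop (λ x → B-set (f x) y) (trans (cong g (sym fx≡y)) (gf x)) }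

isProp⇒isEquiv : {P : Set a} {Q : Set b} (f : P → Q) (g : Q → P)
               → isProp P → isProp Q → isEquiv f
isProp⇒isEquiv f g P-prop Q-prop =
  quasiInverse⇒isEquiv f g (λ _ → P-prop _ _) (λ _ → Q-prop _ _) (isProp⇒isSet Q-prop)

module _ {A : Set a} {B : Set b} {f : A → B} (f-equiv : isEquiv f) where

  equiv-inverse : B → A
  equiv-inverse y = proj₁ (proj₁ (f-equiv y))

  equiv-inverseʳ : ∀ y → f (equiv-inverse y) ≡ y
  equiv-inverseʳ y = proj₂ (proj₁ (f-equiv y))

  equiv-inverseˡ : ∀ x → equiv-inverse (f x) ≡ x
  equiv-inverseˡ x = cong proj₁ (proj₂ (f-equiv (f x)) (x , refl))

  equiv-injective : ∀ {x y} → f x ≡ f y → x ≡ y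
  equiv-injective {x} {y} fx≡fy =
    cong proj₁ (trans (sym (proj₂ (f-equiv (f y)) (x , fx≡fy))) (proj₂ (f-equiv (f y)) (y , refl)))

-- Order isomorphisms with an explicit inverse, which compose more easily than
-- _≅ₒ_; the two notions agree by ≅⇒≅ₒ and ≅ₒ⇒≅.
record _≅_ (β γ : Ordinal ℓ) : Set ℓ where
  field
    to        : Carrier β → Carrier γ
    from      : Carrier γ → Carrier β
    from∘to   : ∀ x → from (to x) ≡ x
    to∘from   : ∀ y → to (from y) ≡ y
    to-mono   : ∀ x y → _≺_ β x y → _≺_ γ (to x) (to y)
    from-mono : ∀ x y → _≺_ γ x y → _≺_ β (from x) (from y)
open _≅_

module _ {ℓ : Level} where

  ≅-refl : {β : Ordinal ℓ} → β ≅ β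
  ≅-refl = record
    { to = id ; from = id ; from∘to = λ _ → refl ; to∘from = λ _ → refl
    ; to-mono = λ _ _ r → r ; from-mono = λ _ _ r → r }

  ≅-sym : {β γ : Ordinal ℓ} → β ≅ γ → γ ≅ β
  ≅-sym h = record
    { to = from h ; from = to h ; from∘to = to∘from h ; to∘from = from∘to h
    ; to-mono = from-mono h ; from-mono = to-mono h }

  ≅-trans : {β γ δ : Ordinal ℓ} → β ≅ γ → γ ≅ δ → β ≅ δ
  ≅-trans h k = record
    { to = λ x → to k (to h x) ; from = λ z → from h (from k z)
    ; from∘to = λ x → trans (cong (from h) (from∘to k (to h x))) (from∘to h x)
    ; to∘from = λ z → trans (cong (to k) (to∘from h (from k z))) (to∘from k z)
    ; to-mono = λ x y r → to-mono k _ _ (to-mono h x y r)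
    ; from-mono = λ x y r → from-mono h _ _ (from-mono k x y r) }

  ↓-cong : {β γ : Ordinal ℓ} (h : β ≅ γ) (u : Carrier β) → (β ↓ u) ≅ (γ ↓ to h u)
  ↓-cong {β} {γ} h u = record
    { to = λ { (v , v≺u) → to h v , to-mono h v u v≺u }
    ; from = λ { (w , w≺hu) →
        from h w , subst (_≺_ β (from h w)) (from∘to h u) (from-mono h w (to h u) w≺hu) }
    ; from∘to = λ { (v , _) → Σ-≡-prop (λ z → ≺-prop β z u) (from∘to h v) }
    ; to∘from = λ { (w , _) → Σ-≡-prop (λ z → ≺-prop γ z (to h u)) (to∘from h w) }
    ; to-mono = λ { (v , _) (v' , _) r → to-mono h v v' r }
    ; from-mono = λ { (w , _) (w' , _) r → from-mono h w w' r } }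

  ↓↓≅↓ : (β : Ordinal ℓ) (u : Carrier β) (v : Carrier (β ↓ u))
       → ((β ↓ u) ↓ v) ≅ (β ↓ proj₁ v)
  ↓↓≅↓ β u (v , v≺u) = record
    { to = λ { ((w , _) , w≺v) → w , w≺v }
    ; from = λ { (w , w≺v) → (w , ≺-trans β w v u w≺v v≺u) , w≺v }
    ; from∘to = λ _ →
        Σ-≡-prop (λ s → ≺-prop β (proj₁ s) v) (Σ-≡-prop (λ z → ≺-prop β z u) refl)
    ; to∘from = λ _ → refl
    ; to-mono = λ _ _ r → r ; from-mono = λ _ _ r → r }

  ↓-cong-↓ : {β γ : Ordinal ℓ} {v : Carrier γ} (h : β ≅ (γ ↓ v)) (x : Carrier β)
           → (β ↓ x) ≅ (γ ↓ proj₁ (to h x))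
  ↓-cong-↓ {γ = γ} {v} h x = ≅-trans (↓-cong h x) (↓↓≅↓ γ v (to h x))

  ↓↓-cong-↓ : {β γ : Ordinal ℓ} {u : Carrier β} {v : Carrier γ} (h : (β ↓ u) ≅ (γ ↓ v))
              (x : Carrier (β ↓ u)) → (β ↓ proj₁ x) ≅ (γ ↓ proj₁ (to h x))
  ↓↓-cong-↓ {β = β} {u = u} h x = ≅-trans (≅-sym (↓↓≅↓ β u x)) (↓-cong-↓ h x)

  ↓-injective : (β : Ordinal ℓ) {u v : Carrier β} → (β ↓ u) ≅ (β ↓ v) → u ≡ v
  ↓-injective β {u} = go u (≺-wf β u)
    where
    go : ∀ u → Acc (_≺_ β) u → ∀ {v} → (β ↓ u) ≅ (β ↓ v) → u ≡ v
    go u (acc rs) {v} h = ≺-ext β u v below-u⇒below-v below-v⇒below-u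
      where
      below-u⇒below-v : ∀ w → _≺_ β w u → _≺_ β w v
      below-u⇒below-v w w≺u = subst (λ z → _≺_ β z v) (sym w≡w') (proj₂ w')
        where
        w' = to h (w , w≺u)
        w≡w' = go w (rs w≺u) (↓↓-cong-↓ h (w , w≺u))

      below-v⇒below-u : ∀ w → _≺_ β w v → _≺_ β w u
      below-v⇒below-u w w≺v = subst (λ z → _≺_ β z u) w'≡w (proj₂ w')
        where
        w' = to (≅-sym h) (w , w≺v)
        w'≡w = go (proj₁ w') (rs (proj₂ w')) (≅-sym (↓↓-cong-↓ (≅-sym h) (w , w≺v)))

module WithTruncation (fe : FunExt) (T : PropTrunc) where
  open PropTrunc T

  isProp-Π : {A : Set a} {B : A → Set b} → ((x : A) → isProp (B x)) → isProp ((x : A) → B x)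
  isProp-Π B-prop f g = fe (λ x → B-prop x (f x) (g x))

  isProp-isProp : {P : Set a} → isProp (isProp P)
  isProp-isProp p q = fe λ x → fe λ y → isProp⇒isSet p x y (p x y) (q x y)

  isProp-Acc : {A : Set a} {_<_ : A → A → Set b} {x : A} → isProp (Acc _<_ x)
  isProp-Acc (acc rs) (acc rs') =
    cong (λ rs″ → acc (λ {y} → rs″ y)) (fe λ y → fe λ y<x → isProp-Acc (rs y<x) (rs' y<x))

  Carrier-isSet : (β : Ordinal ℓ) → isSet (Carrier β)
  Carrier-isSet β = isSet-from-relation SamePredecessors SamePredecessors-isProp
    (λ _ → (λ _ r → r) , (λ _ r → r)) (λ (⊆ , ⊇) → ≺-ext β _ _ ⊆ ⊇)
    where
    SamePredecessors : Carrier β → Carrier β → Set _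
    SamePredecessors x y = ((u : Carrier β) → _≺_ β u x → _≺_ β u y)
                         × ((u : Carrier β) → _≺_ β u y → _≺_ β u x)

    SamePredecessors-isProp : ∀ x y → isProp (SamePredecessors x y)
    SamePredecessors-isProp x y =
      ×-isProp (isProp-Π λ u → isProp-Π λ _ → ≺-prop β u y)
               (isProp-Π λ u → isProp-Π λ _ → ≺-prop β u x)

  ≅⇒≅ₒ : {β γ : Ordinal ℓ} → β ≅ γ → β ≅ₒ γ
  ≅⇒≅ₒ {β = β} {γ} h =
      to h , quasiInverse⇒isEquiv (to h) (from h) (from∘to h) (to∘from h) (Carrier-isSet γ)
    , to-mono h , λ x y r → subst₂ (_≺_ β) (from∘to h x) (from∘to h y) (from-mono h _ _ r)

  ≅ₒ⇒≅ : {β γ : Ordinal ℓ} → β ≅ₒ γ → β ≅ γ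
  ≅ₒ⇒≅ {γ = γ} (f , f-equiv , f-mono , f-reflects) = record
    { to = f ; from = equiv-inverse f-equiv
    ; from∘to = equiv-inverseˡ f-equiv ; to∘from = equiv-inverseʳ f-equiv
    ; to-mono = f-mono
    ; from-mono = λ x y r → f-reflects _ _
        (subst₂ (_≺_ γ) (sym (equiv-inverseʳ f-equiv x)) (sym (equiv-inverseʳ f-equiv y)) r) }

  mono-bijection⇒≅ : {β γ : Ordinal ℓ} (f : Carrier β → Carrier γ)
    → (∀ x y → _≺_ β x y → _≺_ γ (f x) (f y))
    → (∀ x y → _≺_ γ (f x) (f y) → _≺_ β x y)
    → (∀ {x y} → f x ≡ f y → x ≡ y)
    → (∀ y → ∥ fiber f y ∥)
    → β ≅ γ
  mono-bijection⇒≅ {γ = γ} f f-mono f-reflects f-injective f-surjective = record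
    { to = f ; from = λ y → proj₁ (preimage y)
    ; from∘to = λ x → f-injective (proj₂ (preimage (f x)))
    ; to∘from = λ y → proj₂ (preimage y)
    ; to-mono = f-mono
    ; from-mono = λ x y r → f-reflects _ _
        (subst₂ (_≺_ γ) (sym (proj₂ (preimage x))) (sym (proj₂ (preimage y))) r) }
    where
    fiber-isProp : ∀ y → isProp (fiber f y)
    fiber-isProp y (x , p) (x' , q) = Σ-≡-prop (λ _ → Carrier-isSet γ _ _) (f-injective (trans p (sym q)))

    preimage : ∀ y → fiber f y
    preimage y = rec (fiber-isProp y) id (f-surjective y)

  _◁_ : Ordinal ℓ → Ordinal ℓ → Set ℓ
  γ ◁ δ = ∥ Σ (Carrier δ) (λ y → γ ≅ (δ ↓ y)) ∥

  ◁⇒≺ₒ : {γ δ : Ordinal ℓ} → γ ◁ δ → T ⊢ γ ≺ₒ δ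
  ◁⇒≺ₒ = rec squash (λ (y , h) → ∣ y , ≅⇒≅ₒ h ∣)

  ≺ₒ⇒◁ : {γ δ : Ordinal ℓ} → T ⊢ γ ≺ₒ δ → γ ◁ δ
  ≺ₒ⇒◁ = rec squash (λ (y , h) → ∣ y , ≅ₒ⇒≅ h ∣)

  ↓-◁ : (β : Ordinal ℓ) (x : Carrier β) → (β ↓ x) ◁ β
  ↓-◁ β x = ∣ x , ≅-refl ∣

  ◁-respˡ : {γ γ' δ : Ordinal ℓ} → γ ≅ γ' → γ' ◁ δ → γ ◁ δ
  ◁-respˡ k = rec squash (λ (y , h) → ∣ y , ≅-trans k h ∣)

  ◁-respʳ : {γ δ δ' : Ordinal ℓ} → δ ≅ δ' → γ ◁ δ → γ ◁ δ'
  ◁-respʳ k = rec squash (λ (y , h) → ∣ to k y , ≅-trans h (↓-cong k y) ∣)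

  ◁-trans : {γ δ ε : Ordinal ℓ} → γ ◁ δ → δ ◁ ε → γ ◁ ε
  ◁-trans γ◁δ δ◁ε = rec squash (λ (y , h) → rec squash (λ (z , k) →
    ∣ proj₁ (to k y) , ≅-trans h (↓-cong-↓ k y) ∣) δ◁ε) γ◁δ

  ◁-↓ : {γ β : Ordinal ℓ} {u : Carrier β} → γ ◁ (β ↓ u)
      → ∥ Σ (Carrier β) (λ v → _≺_ β v u × γ ≅ (β ↓ v)) ∥
  ◁-↓ {β = β} {u} =
    rec squash (λ ((v , v≺u) , h) → ∣ v , v≺u , ≅-trans h (↓↓≅↓ β u (v , v≺u)) ∣)

  ≺⇒↓◁↓ : (β : Ordinal ℓ) {u v : Carrier β} → _≺_ β u v → (β ↓ u) ◁ (β ↓ v)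
  ≺⇒↓◁↓ β {u} {v} u≺v = ∣ (u , u≺v) , ≅-sym (↓↓≅↓ β v (u , u≺v)) ∣

  ↓◁↓⇒≺ : (β : Ordinal ℓ) {u v : Carrier β} → (β ↓ u) ◁ (β ↓ v) → _≺_ β u v
  ↓◁↓⇒≺ β {u} {v} ↓u◁↓v = rec (≺-prop β u v)
    (λ (v' , v'≺v , h) → subst (λ z → _≺_ β z v) (sym (↓-injective β h)) v'≺v) (◁-↓ ↓u◁↓v)

  ↓-acc : (β : Ordinal ℓ) (y : Carrier β) → Acc (_≺_ β) y
        → (γ : Ordinal ℓ) → γ ≅ (β ↓ y) → Acc _◁_ γ
  ↓-acc β y (acc rs) γ h = acc λ {δ} → rec isProp-Acc (λ (z , k) →
    ↓-acc β (proj₁ (to h z)) (rs (proj₂ (to h z))) δ (≅-trans k (↓-cong-↓ h z)))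

  ◁-wellFounded : WellFounded (_◁_ {ℓ})
  ◁-wellFounded β = acc λ {γ} → rec isProp-Acc (λ (y , h) → ↓-acc β y (≺-wf β y) γ h)

  -- By ↓-injective the position of a proper initial segment is unique, so it
  -- can be extracted from the truncation.
  ◁-position : {γ δ : Ordinal ℓ} → γ ◁ δ → Σ (Carrier δ) (λ y → ∥ γ ≅ (δ ↓ y) ∥)
  ◁-position {γ = γ} {δ} = rec position-isProp (λ (y , h) → y , ∣ h ∣)
    where
    position-isProp : isProp (Σ (Carrier δ) (λ y → ∥ γ ≅ (δ ↓ y) ∥))
    position-isProp (y , h) (y' , h') = Σ-≡-prop (λ _ → squash)
      (rec (Carrier-isSet δ y y') (λ h → rec (Carrier-isSet δ y y') (λ h' →
        ↓-injective δ (≅-trans (≅-sym h) h')) h') h)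

  module SegmentMap (β γ : Ordinal ℓ) (segments◁ : ∀ x → (β ↓ x) ◁ γ) where

    map : Carrier β → Carrier γ
    map x = proj₁ (◁-position (segments◁ x))

    map-matches : ∀ x → ∥ (β ↓ x) ≅ (γ ↓ map x) ∥
    map-matches x = proj₂ (◁-position (segments◁ x))

    map-mono : ∀ x x' → _≺_ β x x' → _≺_ γ (map x) (map x')
    map-mono x x' x≺x' = rec (≺-prop γ _ _) (λ h → rec (≺-prop γ _ _) (λ h' →
        subst (λ t → _≺_ γ t (map x')) (sym (map-x≡ h h')) (proj₂ (to h' (x , x≺x'))))
      (map-matches x')) (map-matches x)
      where
      map-x≡ : (β ↓ x) ≅ (γ ↓ map x) → (h' : (β ↓ x') ≅ (γ ↓ map x'))
             → map x ≡ proj₁ (to h' (x , x≺x'))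
      map-x≡ h h' = ↓-injective γ (≅-trans (≅-sym h) (↓↓-cong-↓ h' (x , x≺x')))

  SegmentMap-inverse : (β γ : Ordinal ℓ) (F : ∀ x → (β ↓ x) ◁ γ) (G : ∀ y → (γ ↓ y) ◁ β)
                     → ∀ x → SegmentMap.map γ β G (SegmentMap.map β γ F x) ≡ x
  SegmentMap-inverse β γ F G x =
    rec (Carrier-isSet β _ _) (λ h → rec (Carrier-isSet β _ _)
      (λ h' → ↓-injective β (≅-sym (≅-trans h h')))
      (SegmentMap.map-matches γ β G (SegmentMap.map β γ F x))) (SegmentMap.map-matches β γ F x)

  ≅-from-segments : (β γ : Ordinal ℓ) → (∀ x → (β ↓ x) ◁ γ) → (∀ y → (γ ↓ y) ◁ β) → β ≅ γ
  ≅-from-segments β γ F G = record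
    { to = Forward.map ; from = Backward.map
    ; from∘to = SegmentMap-inverse β γ F G ; to∘from = SegmentMap-inverse γ β G F
    ; to-mono = Forward.map-mono ; from-mono = Backward.map-mono }
    where
    module Forward = SegmentMap β γ F
    module Backward = SegmentMap γ β G

  segments◁⇒≼ₒ : {β γ : Ordinal ℓ} → (∀ x → (β ↓ x) ◁ γ) → T ⊢ β ≼ₒ γ
  segments◁⇒≼ₒ {γ = γ} segments◁ δ =
    rec (squash {A = Σ (Carrier γ) (λ y → δ ≅ₒ (γ ↓ y))})
        (λ (x , e) → ◁⇒≺ₒ {γ = δ} {γ} (◁-respˡ (≅ₒ⇒≅ e) (segments◁ x)))

module Supremum (fe : FunExt) (pe : PropExt) (T : PropTrunc) (sr : SetReplacement T)
                (𝓥 : Level) (I : Set 𝓥) (α : I → Ord 𝓥) where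
  open PropTrunc T
  open WithTruncation fe T

  Points : Set 𝓥
  Points = Σ I (λ i → Carrier (α i))

  segment : Points → Ord 𝓥
  segment a = α (proj₁ a) ↓ proj₂ a

  _⊏_ : Points → Points → Set 𝓥
  a ⊏ b = segment a ◁ segment b

  ⊏-wellFounded : WellFounded _⊏_
  ⊏-wellFounded = On.wellFounded segment ◁-wellFounded

  HProp : Set (lsuc 𝓥)
  HProp = Σ (Set 𝓥) isProp

  Pred : Set (lsuc 𝓥)
  Pred = Points → HProp

  below : Points → Pred
  below a c = c ⊏ a , squash

  -- The 𝓥-small relation standing in for equality of predicates.
  _≐_ : Pred → Pred → Set 𝓥
  P ≐ Q = (c : Points) → (proj₁ (P c) → proj₁ (Q c)) × (proj₁ (Q c) → proj₁ (P c))

  ≐-refl : (P : Pred) → P ≐ P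
  ≐-refl P c = id , id

  ≐-isProp : ∀ P Q → isProp (P ≐ Q)
  ≐-isProp P Q = isProp-Π λ c → ×-isProp (isProp-Π λ _ → proj₂ (Q c)) (isProp-Π λ _ → proj₂ (P c))

  ≐⇒≡ : ∀ {P Q} → P ≐ Q → P ≡ Q
  ≐⇒≡ {P} {Q} P≐Q = fe λ c →
    Σ-≡-prop (λ _ → isProp-isProp) (pe (proj₂ (P c)) (proj₂ (Q c)) (proj₁ (P≐Q c)) (proj₂ (P≐Q c)))

  ≡⇒≐ : ∀ {P Q} → P ≡ Q → P ≐ Q
  ≡⇒≐ {P} refl = ≐-refl P

  Pred-isSet : isSet Pred
  Pred-isSet = isSet-from-relation _≐_ ≐-isProp ≐-refl ≐⇒≡

  below-≐⇒≅ : ∀ a c → below a ≐ below c → segment a ≅ segment c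
  below-≐⇒≅ a c a≐c = ≅-from-segments (segment a) (segment c) (segments◁ a c a≐c) (segments◁ c a c≐a)
    where
    c≐a : below c ≐ below a
    c≐a d = proj₂ (a≐c d) , proj₁ (a≐c d)

    segments◁ : ∀ a c → below a ≐ below c → ∀ x → (segment a ↓ x) ◁ segment c
    segments◁ (i , _) c a≐c (x , x≺) =
      ◁-respˡ (↓↓≅↓ (α i) _ (x , x≺)) (proj₁ (a≐c (i , x)) (≺⇒↓◁↓ (α i) x≺))

  ≅⇒below-≐ : ∀ {a c} → segment a ≅ segment c → below a ≐ below c
  ≅⇒below-≐ k d = ◁-respʳ k , ◁-respʳ (≅-sym k)

  Image : Set (lsuc 𝓥)
  Image = Σ Pred (λ P → ∃ₜ T Points (λ a → below a ≡ P))

  Image-isSmall : IsSmall 𝓥 Image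
  Image-isSmall = sr below (Points , id , id-isEquiv) Pred-isSet
    (λ P Q → P ≐ Q , ≐⇒≡ , isProp⇒isEquiv ≐⇒≡ ≡⇒≐ (≐-isProp P Q) (Pred-isSet P Q))

  Small : Set 𝓥
  Small = proj₁ Image-isSmall

  embed : Small → Image
  embed = proj₁ (proj₂ Image-isSmall)

  embed-isEquiv : isEquiv embed
  embed-isEquiv = proj₂ (proj₂ Image-isSmall)

  pred : Small → Pred
  pred s = proj₁ (embed s)

  pred-injective : ∀ {s t} → pred s ≡ pred t → s ≡ t
  pred-injective s≡t = equiv-injective embed-isEquiv (Σ-≡-prop (λ _ → squash) s≡t)

  Represents : Small → Points → Set (lsuc 𝓥)
  Represents s a = pred s ≡ below a

  represented : ∀ s → ∥ Σ Points (Represents s) ∥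
  represented s = rec squash (λ (a , p) → ∣ a , sym p ∣) (proj₂ (embed s))

  [_] : Points → Small
  [ a ] = equiv-inverse embed-isEquiv (below a , ∣ a , refl ∣)

  []-represents : ∀ a → Represents [ a ] a
  []-represents a = cong proj₁ (equiv-inverseʳ embed-isEquiv (below a , ∣ a , refl ∣))

  represents-≡ : ∀ {s t a b} → Represents s a → Represents t b → below a ≡ below b → s ≡ t
  represents-≡ r r' a≡b = pred-injective (trans r (trans a≡b (sym r')))

  _<ᴾ_ : Pred → Pred → Set 𝓥
  P <ᴾ Q = ∥ Σ Points (λ c → proj₁ (Q c) × P ≐ below c) ∥

  below-<ᴾ⇒⊏ : ∀ {a b} → below a <ᴾ below b → a ⊏ b
  below-<ᴾ⇒⊏ {a} = rec squash (λ (c , c⊏b , a≐c) → ◁-respˡ (below-≐⇒≅ a c a≐c) c⊏b)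

  ⊏⇒below-<ᴾ : ∀ {a b} → a ⊏ b → below a <ᴾ below b
  ⊏⇒below-<ᴾ {a} a⊏b = ∣ a , a⊏b , ≐-refl (below a) ∣

  _≺ˢ_ : Small → Small → Set 𝓥
  s ≺ˢ t = pred s <ᴾ pred t

  ≺ˢ⇒⊏ : ∀ {s t a b} → Represents s a → Represents t b → s ≺ˢ t → a ⊏ b
  ≺ˢ⇒⊏ r r' s≺t = below-<ᴾ⇒⊏ (subst₂ _<ᴾ_ r r' s≺t)

  ⊏⇒≺ˢ : ∀ {s t a b} → Represents s a → Represents t b → a ⊏ b → s ≺ˢ t
  ⊏⇒≺ˢ r r' a⊏b = subst₂ _<ᴾ_ (sym r) (sym r') (⊏⇒below-<ᴾ a⊏b)

  []-≺ˢ : ∀ {a b} → a ⊏ b → [ a ] ≺ˢ [ b ]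
  []-≺ˢ = ⊏⇒≺ˢ ([]-represents _) ([]-represents _)

  []-≺ˢ⁻¹ : ∀ {a b} → [ a ] ≺ˢ [ b ] → a ⊏ b
  []-≺ˢ⁻¹ = ≺ˢ⇒⊏ ([]-represents _) ([]-represents _)

  ≺ˢ-trans : ∀ s t u → s ≺ˢ t → t ≺ˢ u → s ≺ˢ u
  ≺ˢ-trans s t u s≺t t≺u =
    rec squash (λ (a , ra) → rec squash (λ (b , rb) → rec squash (λ (c , rc) →
      ⊏⇒≺ˢ ra rc (◁-trans (≺ˢ⇒⊏ ra rb s≺t) (≺ˢ⇒⊏ rb rc t≺u)))
    (represented u)) (represented t)) (represented s)

  ≺ˢ-ext : ∀ s t → (∀ u → u ≺ˢ s → u ≺ˢ t) → (∀ u → u ≺ˢ t → u ≺ˢ s) → s ≡ t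
  ≺ˢ-ext s t ⊆ ⊇ = pred-injective
    (rec (Pred-isSet _ _) (λ (a , ra) → rec (Pred-isSet _ _) (λ (b , rb) →
      trans ra (trans (≐⇒≡ (same-predecessors ra rb)) (sym rb)))
    (represented t)) (represented s))
    where
    same-predecessors : ∀ {a b} → Represents s a → Represents t b → below a ≐ below b
    same-predecessors ra rb d =
        (λ d⊏a → ≺ˢ⇒⊏ ([]-represents d) rb (⊆ [ d ] (⊏⇒≺ˢ ([]-represents d) ra d⊏a)))
      , (λ d⊏b → ≺ˢ⇒⊏ ([]-represents d) ra (⊇ [ d ] (⊏⇒≺ˢ ([]-represents d) rb d⊏b)))

  ≺ˢ-acc : ∀ a → Acc _⊏_ a → ∀ s → Represents s a → Acc _≺ˢ_ s
  ≺ˢ-acc a (acc rs) s r = acc λ {t} t≺s →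
    rec isProp-Acc (λ (c , rc) → ≺ˢ-acc c (rs (≺ˢ⇒⊏ rc r t≺s)) t rc) (represented t)

  sup : Ord 𝓥
  sup = record
    { Carrier = Small
    ; _≺_ = _≺ˢ_
    ; ≺-prop = λ _ _ → squash
    ; ≺-trans = ≺ˢ-trans
    ; ≺-ext = ≺ˢ-ext
    ; ≺-wf = λ s → rec isProp-Acc (λ (a , r) → ≺ˢ-acc a (⊏-wellFounded a) s r) (represented s)
    }

  segment≅sup↓ : (a : Points) → segment a ≅ (sup ↓ [ a ])
  segment≅sup↓ a@(i , x) = mono-bijection⇒≅ φ φ-mono φ-reflects φ-injective φ-surjective
    where
    φ : Carrier (segment a) → Carrier (sup ↓ [ a ])
    φ (y , y≺x) = [ i , y ] , []-≺ˢ (≺⇒↓◁↓ (α i) y≺x)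

    φ-mono : ∀ u v → _≺_ (segment a) u v → _≺_ (sup ↓ [ a ]) (φ u) (φ v)
    φ-mono _ _ y≺y' = []-≺ˢ (≺⇒↓◁↓ (α i) y≺y')

    φ-reflects : ∀ u v → _≺_ (sup ↓ [ a ]) (φ u) (φ v) → _≺_ (segment a) u v
    φ-reflects _ _ φu≺φv = ↓◁↓⇒≺ (α i) ([]-≺ˢ⁻¹ φu≺φv)

    φ-injective : ∀ {u v} → φ u ≡ φ v → u ≡ v
    φ-injective {y , _} {y' , _} φu≡φv = Σ-≡-prop (λ z → ≺-prop (α i) z x)
      (↓-injective (α i) (below-≐⇒≅ (i , y) (i , y') (≡⇒≐ below-y≡below-y')))
      where
      below-y≡below-y' : below (i , y) ≡ below (i , y')
      below-y≡below-y' = trans (sym ([]-represents (i , y)))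
        (trans (cong (pred ∘ proj₁) φu≡φv) ([]-represents (i , y')))

    φ-surjective : ∀ t → ∥ fiber φ t ∥
    φ-surjective (s , s≺a) = rec squash (λ (c , rc) → rec squash (λ (y , y≺x , c≅y) →
        ∣ (y , y≺x) , Σ-≡-prop (λ _ → squash)
            (represents-≡ ([]-represents (i , y)) rc (≐⇒≡ (≅⇒below-≐ (≅-sym c≅y)))) ∣)
      (◁-↓ (≺ˢ⇒⊏ rc ([]-represents a) s≺a))) (represented s)

  sup↓≅segment : ∀ {s a} → Represents s a → (sup ↓ s) ≅ segment a
  sup↓≅segment {s} {a} r =
    subst (λ t → (sup ↓ t) ≅ segment a) (represents-≡ ([]-represents a) r refl)
          (≅-sym (segment≅sup↓ a))

  sup-upper : ∀ i → T ⊢ α i ≼ₒ sup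
  sup-upper i = segments◁⇒≼ₒ (λ x → ◁-respˡ (segment≅sup↓ (i , x)) (↓-◁ sup [ i , x ]))

  sup-least : (γ : Ord 𝓥) → (∀ i → T ⊢ α i ≼ₒ γ) → T ⊢ sup ≼ₒ γ
  sup-least γ α≼γ = segments◁⇒≼ₒ {β = sup} λ s → rec squash (λ ((i , x) , r) →
    ◁-respˡ (sup↓≅segment r) (segment◁γ i x)) (represented s)
    where
    segment◁γ : ∀ i x → (α i ↓ x) ◁ γ
    segment◁γ i x =
      ≺ₒ⇒◁ {γ = α i ↓ x} (α≼γ i (α i ↓ x) (◁⇒≺ₒ {γ = α i ↓ x} (↓-◁ (α i) x)))

mainTheorem9 : (fe : FunExt) (pe : PropExt) (T : PropTrunc)
               (sr : SetReplacement T)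
               (𝓥 : Level) (ua : IsUnivalent 𝓥)
               (I : Set 𝓥) (α : I → Ord 𝓥)
               → HasLUB T α
mainTheorem9 fe pe T sr 𝓥 _ I α = sup , sup-upper , sup-least
  where open Supremum fe pe T sr 𝓥 I α
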